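{- Let $q$ be a prime power and $n$ a positive integer, and let $N=\frac{q^n-1}{q-1}$, $N'=N-n$, $k=q^{n-1}-1$. Then the $k$ highest-degree terms of the polynomial $\chi_{PG(n-1,q)^*}(x)$ are $$x^{N'}-N x^{N'-1}+\binom{N}{2}x^{N'-2}-\ldots+(-1)^{k-1}\binom{N}{k-1}x^{N'-k+1}.$$ That is, $\chi_{PG(n-1,q)^*}(x)$ has no terms of degree greater than $N'$, and for every integer $i$ with $0\le i\le k-1$ the coefficient of $x^{N'-i}$ in it equals $(-1)^i\binom{N}{i}$.
   Context: $PG(n-1,q)$ denotes the matroid whose ground set $E$ is the set of all points of the $(n-1)$-dimensional projective space over the finite field $\mathbb{F}_q$ (i.e. the one-dimensional subspaces of $\mathbb{F}_q^n$), the rank $r(A)$ of $A\subseteq E$ being the dimension of the linear subspace of $\mathbb{F}_q^n$ spanned by $A$. The dual $M^*=(E,r^*)$ of a matroid $M=(E,r)$ has rank function $r^*(A)=r(E-A)+|A|-r(E)$, and the characteristic polynomial of a matroid $M=(E,r)$ is $\chi_M(x)=\sum_{A\subseteq E}(-1)^{|A|}x^{r(E)-r(A)}$. -}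

module Defs where

open import Level using (Level; _⊔_) renaming (suc to lsuc)
open import Algebra.Bundles using (CommutativeRing)
import Algebra.Properties.Ring
import Algebra.Properties.Semiring.Sum
import Algebra.Lattice.Properties.BooleanAlgebra
open import Data.Bool.Base using (true; false)
open import Data.Fin.Base as Fin using (Fin; zero; suc; funToFin; finToFun)
import Data.Fin.Properties as Fin
open import Data.Fin.Subset as Subset
  using (Subset; inside; outside; ∣_∣; ∁; _∩_; _∪_; _⊆_; ⊤)
import Data.Fin.Subset.Properties as Subset
open import Data.Integer.Base as ℤ using (ℤ; 0ℤ; -1ℤ)
open import Data.List.Base as List
  using (List; []; _∷_; _++_; length; lookup; map; mapMaybe; foldr; deduplicate; replicate)
import Data.List.Properties as List
open import Data.List.Membership.Propositional using (_∈_)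
open import Data.List.Membership.Propositional.Properties using (∈-++⁺ˡ; ∈-++⁺ʳ; ∈-++⁻; ∈-map⁺; ∈-map⁻)
open import Data.List.Relation.Unary.Any using (here; there)
import Data.List.Relation.Unary.Any.Properties as Any
import Data.List.Relation.Unary.Enumerates.Setoid as Enumerates
import Data.List.Relation.Unary.Enumerates.Setoid.Properties as Enumerates
import Data.List.Relation.Unary.Unique.Setoid as Unique
import Data.List.Relation.Unary.Unique.DecSetoid.Properties as Unique
open import Data.Maybe.Base using (Maybe; just; nothing)
import Data.Maybe.Relation.Unary.Any as Maybe
open import Data.Nat.Base as ℕ
  using (ℕ; zero; suc; _+_; _*_; _∸_; _^_; _≤_; _<_; z≤n; s≤s; NonZero)
import Data.Nat.Properties as ℕ
open import Data.Nat.Primality using (Prime; prime⇒nonTrivial)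
open import Data.Product.Base using (Σ; ∃; ∃₂; _×_; _,_; proj₁; proj₂)
open import Data.Sum.Base using (_⊎_; inj₁; inj₂; [_,_]′; map₁; map₂)
open import Data.Vec.Base as Vec using ([]; _∷_)
open import Data.Vec.Functional as Vector using (Vector)
import Data.Vec.Functional.Relation.Binary.Equality.Setoid
open import Function.Base using (_∘_; id)
open import Function.Bundles using (Inverse; _⇔_; mk⇔; Equivalence)
open import Relation.Binary.Bundles using (DecSetoid)
open import Relation.Binary.PropositionalEquality as ≡ using (_≡_; refl; cong; cong₂; subst)
open import Relation.Nullary using (¬_; Dec; yes; no; contradiction)
import Relation.Nullary.Decidable as Dec
open import Relation.Unary using (Pred)

private
  variable
    a c ℓ : Level
    q : ℕ

-- Coefficients in order of increasing degree; trailing zeros are allowed.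
Polynomial : Set
Polynomial = List ℤ

coeff : Polynomial → ℕ → ℤ
coeff []      _       = 0ℤ
coeff (a ∷ p) zero    = a
coeff (a ∷ p) (suc d) = coeff p d

infixl 6 _+ₚ_

_+ₚ_ : Polynomial → Polynomial → Polynomial
[]      +ₚ p       = p
(a ∷ p) +ₚ []      = a ∷ p
(a ∷ p) +ₚ (b ∷ r) = a ℤ.+ b ∷ p +ₚ r

monomial : ℤ → ℕ → Polynomial
monomial a d = replicate d 0ℤ ++ a ∷ []

sumₚ : List Polynomial → Polynomial
sumₚ = foldr _+ₚ_ []

record Matroid : Set where
  field
    size       : ℕ
    rank       : Subset size → ℕ
    rank≤∣∣    : ∀ A → rank A ≤ ∣ A ∣
    rank-mono  : ∀ A B → A ⊆ B → rank A ≤ rank B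
    submodular : ∀ A B → rank (A ∪ B) + rank (A ∩ B) ≤ rank A + rank B

allSubsets : ∀ m → List (Subset m)
allSubsets zero    = [] ∷ []
allSubsets (suc m) =
  map (outside ∷_) (allSubsets m) ++ map (inside ∷_) (allSubsets m)

-- Truncated subtraction is exact here, by rank-mono.
characteristicPolynomial : Matroid → Polynomial
characteristicPolynomial M =
  sumₚ (map (λ A → monomial (-1ℤ ℤ.^ ∣ A ∣) (rank ⊤ ∸ rank A)) (allSubsets size))
  where open Matroid M

∣∪∣+∣∩∣ : ∀ {m} (A B : Subset m) → ∣ A ∪ B ∣ + ∣ A ∩ B ∣ ≡ ∣ A ∣ + ∣ B ∣
∣∪∣+∣∩∣ []          []          = refl
∣∪∣+∣∩∣ (false ∷ A) (false ∷ B) = ∣∪∣+∣∩∣ A B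
∣∪∣+∣∩∣ (false ∷ A) (true  ∷ B) =
  ≡.trans (cong suc (∣∪∣+∣∩∣ A B)) (≡.sym (ℕ.+-suc ∣ A ∣ ∣ B ∣))
∣∪∣+∣∩∣ (true  ∷ A) (false ∷ B) = cong suc (∣∪∣+∣∩∣ A B)
∣∪∣+∣∩∣ (true  ∷ A) (true  ∷ B) = cong suc
  (≡.trans (ℕ.+-suc _ _)
    (≡.trans (cong suc (∣∪∣+∣∩∣ A B)) (≡.sym (ℕ.+-suc ∣ A ∣ ∣ B ∣))))

∣─∣ : ∀ {m} (A B : Subset m) → A ⊆ B → ∣ B ∩ ∁ A ∣ + ∣ A ∣ ≤ ∣ B ∣
∣─∣ []          []          _   = z≤n
∣─∣ (false ∷ A) (false ∷ B) A⊆B = ∣─∣ A B (Subset.drop-∷-⊆ A⊆B)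
∣─∣ (false ∷ A) (true  ∷ B) A⊆B = s≤s (∣─∣ A B (Subset.drop-∷-⊆ A⊆B))
∣─∣ (true  ∷ A) (false ∷ B) A⊆B with () ← A⊆B Vec.here
∣─∣ (true  ∷ A) (true  ∷ B) A⊆B =
  ℕ.≤-trans (ℕ.≤-reflexive (ℕ.+-suc _ _)) (s≤s (∣─∣ A B (Subset.drop-∷-⊆ A⊆B)))

module Dual (M : Matroid) where
  open Matroid M
  open ℕ.≤-Reasoning
  module BA {m} =
    Algebra.Lattice.Properties.BooleanAlgebra (Subset.∪-∩-booleanAlgebra m)

  f : Subset size → ℕ
  f A = rank (∁ A) + ∣ A ∣

  rank-∪ : ∀ A B → rank (A ∪ B) ≤ rank A + ∣ B ∣
  rank-∪ A B = begin
    rank (A ∪ B)                  ≤⟨ ℕ.m≤m+n _ _ ⟩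
    rank (A ∪ B) + rank (A ∩ B)   ≤⟨ submodular A B ⟩
    rank A + rank B               ≤⟨ ℕ.+-monoʳ-≤ (rank A) (rank≤∣∣ B) ⟩
    rank A + ∣ B ∣                ∎

  ⊤≤f : ∀ A → rank ⊤ ≤ f A
  ⊤≤f A = begin
    rank ⊤            ≡⟨ cong rank (≡.trans (Subset.∪-comm (∁ A) A) (Subset.p∪∁p≡⊤ A)) ⟨
    rank (∁ A ∪ A)    ≤⟨ rank-∪ (∁ A) A ⟩
    f A               ∎

  f-mono : ∀ A B → A ⊆ B → f A ≤ f B
  f-mono A B A⊆B = begin
    rank (∁ A) + ∣ A ∣                       ≤⟨ ℕ.+-monoˡ-≤ ∣ A ∣ (rank-mono _ _ ∁A⊆) ⟩
    rank (∁ B ∪ (B ∩ ∁ A)) + ∣ A ∣           ≤⟨ ℕ.+-monoˡ-≤ ∣ A ∣ (rank-∪ (∁ B) (B ∩ ∁ A)) ⟩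
    rank (∁ B) + ∣ B ∩ ∁ A ∣ + ∣ A ∣         ≡⟨ ℕ.+-assoc (rank (∁ B)) _ _ ⟩
    rank (∁ B) + (∣ B ∩ ∁ A ∣ + ∣ A ∣)       ≤⟨ ℕ.+-monoʳ-≤ (rank (∁ B)) (∣─∣ A B A⊆B) ⟩
    rank (∁ B) + ∣ B ∣                       ∎
    where
    ∁A⊆ : ∁ A ⊆ ∁ B ∪ (B ∩ ∁ A)
    ∁A⊆ {x} x∈∁A with x Subset.∈? B
    ... | yes x∈B = Subset.x∈p∪q⁺ (inj₂ (Subset.x∈p∩q⁺ (x∈B , x∈∁A)))
    ... | no  x∉B = Subset.x∈p∪q⁺ (inj₁ (Subset.x∉p⇒x∈∁p x∉B))

  interchange : ∀ w x y z → (w + x) + (y + z) ≡ (w + y) + (x + z)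
  interchange w x y z = begin-equality
    (w + x) + (y + z)   ≡⟨ ℕ.+-assoc w x (y + z) ⟩
    w + (x + (y + z))   ≡⟨ cong (w +_) (ℕ.+-assoc x y z) ⟨
    w + ((x + y) + z)   ≡⟨ cong (λ t → w + (t + z)) (ℕ.+-comm x y) ⟩
    w + ((y + x) + z)   ≡⟨ cong (w +_) (ℕ.+-assoc y x z) ⟩
    w + (y + (x + z))   ≡⟨ ℕ.+-assoc w y (x + z) ⟨
    (w + y) + (x + z)   ∎

  f-submodular : ∀ A B → f (A ∪ B) + f (A ∩ B) ≤ f A + f B
  f-submodular A B = begin
    f (A ∪ B) + f (A ∩ B)
      ≡⟨ interchange (rank (∁ (A ∪ B))) _ _ _ ⟩
    (rank (∁ (A ∪ B)) + rank (∁ (A ∩ B))) + (∣ A ∪ B ∣ + ∣ A ∩ B ∣)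
      ≡⟨ cong₂ _+_
           (≡.trans (ℕ.+-comm (rank (∁ (A ∪ B))) _)
             (cong₂ (λ S T → rank S + rank T) (BA.deMorgan₁ A B) (BA.deMorgan₂ A B)))
           (∣∪∣+∣∩∣ A B) ⟩
    (rank (∁ A ∪ ∁ B) + rank (∁ A ∩ ∁ B)) + (∣ A ∣ + ∣ B ∣)
      ≤⟨ ℕ.+-monoˡ-≤ (∣ A ∣ + ∣ B ∣) (submodular (∁ A) (∁ B)) ⟩
    (rank (∁ A) + rank (∁ B)) + (∣ A ∣ + ∣ B ∣)
      ≡⟨ interchange (rank (∁ A)) _ _ _ ⟩
    f A + f B ∎

  ∸-+-∸ : ∀ {x y z} → z ≤ x → z ≤ y → (x ∸ z) + (y ∸ z) ≡ (x + y) ∸ (z + z)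
  ∸-+-∸ {x} {y} {z} z≤x z≤y = begin-equality
    (x ∸ z) + (y ∸ z)   ≡⟨ ℕ.+-∸-assoc (x ∸ z) z≤y ⟨
    (x ∸ z) + y ∸ z     ≡⟨ cong (_∸ z) (ℕ.+-∸-comm y z≤x) ⟨
    x + y ∸ z ∸ z       ≡⟨ ℕ.∸-+-assoc (x + y) z z ⟩
    (x + y) ∸ (z + z)   ∎

  rank* : Subset size → ℕ
  rank* A = rank (∁ A) + ∣ A ∣ ∸ rank ⊤

  rank*≤∣∣ : ∀ A → rank* A ≤ ∣ A ∣
  rank*≤∣∣ A = begin
    rank (∁ A) + ∣ A ∣ ∸ rank ⊤   ≤⟨ ℕ.∸-monoˡ-≤ (rank ⊤) (ℕ.+-monoˡ-≤ ∣ A ∣ (rank-mono _ _ (Subset.⊆-max _))) ⟩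
    rank ⊤ + ∣ A ∣ ∸ rank ⊤       ≡⟨ ℕ.m+n∸m≡n (rank ⊤) ∣ A ∣ ⟩
    ∣ A ∣                         ∎

  rank*-submodular : ∀ A B → rank* (A ∪ B) + rank* (A ∩ B) ≤ rank* A + rank* B
  rank*-submodular A B = begin
    rank* (A ∪ B) + rank* (A ∩ B)
      ≡⟨ ∸-+-∸ (⊤≤f (A ∪ B)) (⊤≤f (A ∩ B)) ⟩
    f (A ∪ B) + f (A ∩ B) ∸ (rank ⊤ + rank ⊤)
      ≤⟨ ℕ.∸-monoˡ-≤ (rank ⊤ + rank ⊤) (f-submodular A B) ⟩
    f A + f B ∸ (rank ⊤ + rank ⊤)
      ≡⟨ ∸-+-∸ (⊤≤f A) (⊤≤f B) ⟨
    rank* A + rank* B ∎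

-- Truncated subtraction is exact here, since rank ⊤ ≤ rank (∁ A) + ∣ A ∣.
dual : Matroid → Matroid
dual M = record
  { size       = size
  ; rank       = λ A → rank (∁ A) + ∣ A ∣ ∸ rank ⊤
  ; rank≤∣∣    = rank*≤∣∣
  ; rank-mono  = λ A B A⊆B → ℕ.∸-monoˡ-≤ (rank ⊤) (f-mono A B A⊆B)
  ; submodular = rank*-submodular
  }
  where
  open Matroid M
  open Dual M

IsPrimePower : ℕ → Set
IsPrimePower q = ∃₂ λ p e → Prime p × 1 ≤ e × q ≡ p ^ e

primePower⇒∸1-nonZero : IsPrimePower q → NonZero (q ∸ 1)
primePower⇒∸1-nonZero (p , e , p-prime , 1≤e , refl) = ℕ.>-nonZero
  (ℕ.m<n⇒0<n∸m (ℕ.<-≤-trans 1<p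
    (ℕ.≤-trans (ℕ.≤-reflexive (≡.sym (ℕ.^-identityʳ p))) (ℕ.^-monoʳ-≤ p 1≤e))))
  where
  1<p : 1 < p
  1<p = ℕ.nonTrivial⇒n>1 p ⦃ prime⇒nonTrivial p-prime ⦄
  instance
    p≢0 : NonZero p
    p≢0 = ℕ.>-nonZero (ℕ.<-trans (s≤s z≤n) 1<p)

record IsField (R : CommutativeRing c ℓ) : Set (c ⊔ ℓ) where
  open CommutativeRing R using (_≈_; 0#; 1#) renaming (_*_ to _·_)
  field
    0≉1     : ¬ 0# ≈ 1#
    inverse : ∀ x → ¬ x ≈ 0# → ∃ λ y → x · y ≈ 1#

record FiniteField c ℓ (q : ℕ) : Set (lsuc (c ⊔ ℓ)) where
  field
    commutativeRing : CommutativeRing c ℓ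
    isField         : IsField commutativeRing
    enumeration     : Inverse (CommutativeRing.setoid commutativeRing) (≡.setoid (Fin q))

  open CommutativeRing commutativeRing public
  open IsField isField public

select : {X : Set a} (xs : List X) → Subset (length xs) → List X
select []       []            = []
select (x ∷ xs) (outside ∷ A) = select xs A
select (x ∷ xs) (inside  ∷ A) = x ∷ select xs A

module _ {X : Set a} where
  length-select : ∀ (xs : List X) A → length (select xs A) ≡ ∣ A ∣
  length-select []       []          = refl
  length-select (x ∷ xs) (false ∷ A) = length-select xs A
  length-select (x ∷ xs) (true  ∷ A) = cong suc (length-select xs A)

  select-mono : ∀ (xs : List X) A B → A ⊆ B → ∀ {x} → x ∈ select xs A → x ∈ select xs B
  select-mono []       []          []          _   ()
  select-mono (x ∷ xs) (false ∷ A) (false ∷ B) A⊆B x∈ =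
    select-mono xs A B (Subset.drop-∷-⊆ A⊆B) x∈
  select-mono (x ∷ xs) (false ∷ A) (true  ∷ B) A⊆B x∈ =
    there (select-mono xs A B (Subset.drop-∷-⊆ A⊆B) x∈)
  select-mono (x ∷ xs) (true  ∷ A) (false ∷ B) A⊆B x∈ with () ← A⊆B Vec.here
  select-mono (x ∷ xs) (true  ∷ A) (true  ∷ B) A⊆B (here eq) = here eq
  select-mono (x ∷ xs) (true  ∷ A) (true  ∷ B) A⊆B (there x∈) =
    there (select-mono xs A B (Subset.drop-∷-⊆ A⊆B) x∈)

  select-∪ : ∀ (xs : List X) A B {x} → x ∈ select xs (A ∪ B) →
    x ∈ select xs A ⊎ x ∈ select xs B
  select-∪ []       []          []          ()
  select-∪ (x ∷ xs) (false ∷ A) (false ∷ B) x∈ = select-∪ xs A B x∈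
  select-∪ (x ∷ xs) (false ∷ A) (true  ∷ B) (here eq) = inj₂ (here eq)
  select-∪ (x ∷ xs) (false ∷ A) (true  ∷ B) (there x∈) = map₂ there (select-∪ xs A B x∈)
  select-∪ (x ∷ xs) (true  ∷ A) (b     ∷ B) (here eq) = inj₁ (here eq)
  select-∪ (x ∷ xs) (true  ∷ A) (false ∷ B) (there x∈) = map₁ there (select-∪ xs A B x∈)
  select-∪ (x ∷ xs) (true  ∷ A) (true  ∷ B) (there x∈) =
    Data.Sum.Base.map there there (select-∪ xs A B x∈)

module LinearAlgebra (F : FiniteField c ℓ q) (n : ℕ) where

  open FiniteField F
    hiding (zero)
    renaming (Carrier to K; _+_ to _⊕_; _*_ to _⊗_; refl to ≈-refl; sym to ≈-sym; trans to ≈-trans)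
  open Data.Vec.Functional.Relation.Binary.Equality.Setoid setoid public
  open Algebra.Properties.Semiring.Sum semiring using (sum; ∑-distrib-+; *-distribˡ-sum; sum-cong-≋)
  open import Relation.Binary.Reasoning.Setoid setoid
  private module R = Algebra.Properties.Ring ring
  private module E = Inverse enumeration

  V : Set c
  V = Vector K n

  0ᵥ : V
  0ᵥ _ = 0#

  infixl 6 _+ᵥ_
  infixr 7 _·ᵥ_

  _+ᵥ_ : V → V → V
  (v +ᵥ w) j = v j ⊕ w j

  _·ᵥ_ : K → V → V
  (x ·ᵥ v) j = x ⊗ v j

  -- The smallest linear subspace containing the listed vectors.
  data Span (vs : List V) : V → Set (c ⊔ ℓ) where
    gen   : ∀ {v} → v ∈ vs → Span vs v
    zero  : Span vs 0ᵥ
    add   : ∀ {v w} → Span vs v → Span vs w → Span vs (v +ᵥ w)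
    scale : ∀ x {v} → Span vs v → Span vs (x ·ᵥ v)
    resp  : ∀ {v w} → v ≋ w → Span vs v → Span vs w

  linComb : ∀ {m} → Vector K m → Vector V m → V
  linComb x vs j = sum (λ i → x i ⊗ vs i j)

  LinearlyIndependent : List V → Set (c ⊔ ℓ)
  LinearlyIndependent vs = ∀ (x : Vector K (length vs)) →
    linComb x (lookup vs) ≋ 0ᵥ → ∀ i → x i ≈ 0#

  IsBasis : ∀ {p} → List V → Pred V p → Set (c ⊔ ℓ ⊔ p)
  IsBasis bs W = LinearlyIndependent bs × (∀ w → W w ⇔ Span bs w)

  HasDimension : ∀ {p} → Pred V p → ℕ → Set (c ⊔ ℓ ⊔ p)
  HasDimension W d = ∃ λ bs → IsBasis bs W × length bs ≡ d

  Span-⊆ : ∀ {vs ws} → (∀ {v} → v ∈ vs → Span ws v) → ∀ {v} → Span vs v → Span ws v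
  Span-⊆ h (gen v∈)     = h v∈
  Span-⊆ h zero         = zero
  Span-⊆ h (add s t)    = add (Span-⊆ h s) (Span-⊆ h t)
  Span-⊆ h (scale x s)  = scale x (Span-⊆ h s)
  Span-⊆ h (resp v≋w s) = resp v≋w (Span-⊆ h s)

  Span-mono : ∀ {vs ws} → (∀ {v} → v ∈ vs → v ∈ ws) → ∀ {v} → Span vs v → Span ws v
  Span-mono h = Span-⊆ (gen ∘ h)

  exchange⁻ : ∀ {v vs w} → Span (v ∷ vs) w → ∃ λ x → Span vs (w +ᵥ x ·ᵥ v)
  exchange⁻ {v} (gen (here refl)) = - 1# , resp
    (λ j → ≈-sym (≈-trans (+-congˡ (R.-1*x≈-x (v j))) (-‿inverseʳ (v j)))) zero
  exchange⁻ {v} (gen {w} (there w∈vs)) = 0# , resp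
    (λ j → ≈-sym (≈-trans (+-congˡ (zeroˡ (v j))) (+-identityʳ (w j)))) (gen w∈vs)
  exchange⁻ {v} zero = 0# , resp
    (λ j → ≈-sym (≈-trans (+-congˡ (zeroˡ (v j))) (+-identityʳ 0#))) zero
  exchange⁻ {v} (add {u} {w} s t) with exchange⁻ s | exchange⁻ t
  ... | x , s′ | y , t′ = x ⊕ y , resp
    (λ j → begin
      (u j ⊕ x ⊗ v j) ⊕ (w j ⊕ y ⊗ v j)   ≈⟨ +-assoc _ _ _ ⟩
      u j ⊕ (x ⊗ v j ⊕ (w j ⊕ y ⊗ v j))   ≈⟨ +-congˡ (+-assoc _ _ _) ⟨
      u j ⊕ ((x ⊗ v j ⊕ w j) ⊕ y ⊗ v j)   ≈⟨ +-congˡ (+-congʳ (+-comm _ _)) ⟩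
      u j ⊕ ((w j ⊕ x ⊗ v j) ⊕ y ⊗ v j)   ≈⟨ +-congˡ (+-assoc _ _ _) ⟩
      u j ⊕ (w j ⊕ (x ⊗ v j ⊕ y ⊗ v j))   ≈⟨ +-assoc _ _ _ ⟨
      (u j ⊕ w j) ⊕ (x ⊗ v j ⊕ y ⊗ v j)   ≈⟨ +-congˡ (distribʳ (v j) x y) ⟨
      (u j ⊕ w j) ⊕ (x ⊕ y) ⊗ v j         ∎)
    (add s′ t′)
  exchange⁻ {v} (scale x {w} s) with exchange⁻ s
  ... | y , s′ = x ⊗ y , resp
    (λ j → ≈-trans (distribˡ x (w j) _) (+-congˡ (≈-sym (*-assoc x y (v j)))))
    (scale x s′)
  exchange⁻ (resp u≋w s) with exchange⁻ s
  ... | y , s′ = y , resp (λ j → +-congʳ (u≋w j)) s′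

  exchange⁺ : ∀ {v vs w} x → Span vs (w +ᵥ x ·ᵥ v) → Span (v ∷ vs) w
  exchange⁺ {v} {vs} {w} x s = resp
    (λ j → begin
      (w j ⊕ x ⊗ v j) ⊕ - 1# ⊗ (x ⊗ v j)   ≈⟨ +-congˡ (R.-1*x≈-x _) ⟩
      (w j ⊕ x ⊗ v j) ⊕ - (x ⊗ v j)        ≈⟨ +-assoc _ _ _ ⟩
      w j ⊕ (x ⊗ v j ⊕ - (x ⊗ v j))        ≈⟨ +-congˡ (-‿inverseʳ _) ⟩
      w j ⊕ 0#                             ≈⟨ +-identityʳ _ ⟩
      w j                                  ∎)
    (add (Span-mono there s) (scale (- 1#) (scale x (gen (here refl)))))

  Span-[] : ∀ {w} → Span [] w → w ≋ 0ᵥ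
  Span-[] zero j         = ≈-refl
  Span-[] (add s t) j    = ≈-trans (+-cong (Span-[] s j) (Span-[] t j)) (+-identityʳ 0#)
  Span-[] (scale x s) j  = ≈-trans (*-congˡ (Span-[] s j)) (zeroʳ x)
  Span-[] (resp v≋w s) j = ≈-trans (≈-sym (v≋w j)) (Span-[] s j)

  from-to : ∀ x → E.from (E.to x) ≈ x
  from-to x = E.strictlyInverseʳ x

  infix 4 _≈?_ _≋?_

  _≈?_ : ∀ x y → Dec (x ≈ y)
  x ≈? y = Dec.map′
    (λ eq → ≈-trans (≈-sym (from-to x)) (≈-trans (E.from-cong eq) (from-to y)))
    E.to-cong (E.to x Fin.≟ E.to y)

  _≋?_ : ∀ (v w : V) → Dec (v ≋ w)
  v ≋? w = Fin.all? (λ j → v j ≈? w j)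

  Span? : ∀ vs w → Dec (Span vs w)
  Span? [] w = Dec.map′ (λ w≋0 → resp (λ j → ≈-sym (w≋0 j)) zero) Span-[] (w ≋? 0ᵥ)
  Span? (v ∷ vs) w = Dec.map′
    (λ (i , s) → exchange⁺ (E.from i) s)
    (λ s → let x , s′ = exchange⁻ s in E.to x ,
      resp (λ j → +-congˡ (*-congʳ (≈-sym (from-to x)))) s′)
    (Fin.any? (λ i → Span? vs (w +ᵥ E.from i ·ᵥ v)))

  linComb∈Span : ∀ vs (x : Vector K (length vs)) → Span vs (linComb x (lookup vs))
  linComb∈Span []       x = zero
  linComb∈Span (v ∷ vs) x = add (scale (x zero) (gen (here refl)))
    (Span-mono there (linComb∈Span vs (x ∘ suc)))

  linComb-cong : ∀ {m} {x y : Vector K m} (vs : Vector V m) →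
    (∀ i → x i ≈ y i) → linComb x vs ≋ linComb y vs
  linComb-cong vs x≈y j = sum-cong-≋ (λ i → *-congʳ (x≈y i))

  linComb-+ : ∀ {m} (x y : Vector K m) (vs : Vector V m) →
    linComb (λ i → x i ⊕ y i) vs ≋ linComb x vs +ᵥ linComb y vs
  linComb-+ x y vs j = ≈-trans
    (sum-cong-≋ (λ i → distribʳ (vs i j) (x i) (y i)))
    (∑-distrib-+ (λ i → x i ⊗ vs i j) (λ i → y i ⊗ vs i j))

  linComb-· : ∀ {m} z (x : Vector K m) (vs : Vector V m) →
    linComb (λ i → z ⊗ x i) vs ≋ z ·ᵥ linComb x vs
  linComb-· z x vs j = ≈-trans
    (sum-cong-≋ (λ i → *-assoc z (x i) (vs i j)))
    (≈-sym (*-distribˡ-sum z (λ i → x i ⊗ vs i j)))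

  linComb-0 : ∀ {m} (vs : Vector V m) → linComb (λ _ → 0#) vs ≋ 0ᵥ
  linComb-0 {zero}  vs j = ≈-refl
  linComb-0 {suc m} vs j = ≈-trans
    (+-cong (zeroˡ (vs zero j)) (linComb-0 (vs ∘ suc) j)) (+-identityʳ 0#)

  coordinates : ∀ {vs w} → Span vs w → ∃ λ x → linComb x (lookup vs) ≋ w
  coordinates {vs} zero = _ , linComb-0 (lookup vs)
  coordinates {vs} (add s t) with coordinates s | coordinates t
  ... | x , p | y , r = _ , λ j → ≈-trans (linComb-+ x y (lookup vs) j) (+-cong (p j) (r j))
  coordinates {vs} (scale z s) with coordinates s
  ... | x , p = _ , λ j → ≈-trans (linComb-· z x (lookup vs) j) (*-congˡ (p j))
  coordinates (resp v≋w s) with coordinates s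
  ... | x , p = x , λ j → ≈-trans (p j) (v≋w j)
  coordinates (gen v∈vs) = unit v∈vs
    where
    unit : ∀ {vs w} → w ∈ vs → ∃ λ x → linComb x (lookup vs) ≋ w
    unit {v ∷ vs} (here refl) = 1# Vector.∷ (λ _ → 0#) , λ j → ≈-trans
      (+-cong (*-identityˡ (v j)) (linComb-0 (lookup vs) j)) (+-identityʳ (v j))
    unit {v ∷ vs} {w} (there w∈vs) with unit w∈vs
    ... | x , p = 0# Vector.∷ x , λ j → ≈-trans
      (+-cong (zeroˡ (v j)) (p j)) (+-identityˡ (w j))

  1<q : 1 < q
  1<q = helper q E.to (λ eq → 0≉1
    (≈-trans (≈-sym (from-to 0#)) (≈-trans (E.from-cong eq) (from-to 1#))))
    where
    helper : ∀ m (g : K → Fin m) → ¬ g 0# ≡ g 1# → 1 < m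
    helper zero          g _ with () ← g 0#
    helper (suc zero)    g g0≢g1 with g 0# | g 1#
    ... | zero | zero = contradiction refl g0≢g1
    helper (suc (suc m)) g _ = s≤s (s≤s z≤n)

  encode : ∀ {m} → Vector K m → Fin (q ^ m)
  encode x = funToFin (E.to ∘ x)

  decode : ∀ {m} → Fin (q ^ m) → Vector K m
  decode k = E.from ∘ finToFun k

  decode-encode : ∀ {m} (x : Vector K m) i → decode (encode x) i ≈ x i
  decode-encode x i = ≈-trans
    (E.from-cong (Fin.finToFun-funToFin (E.to ∘ x) i)) (from-to (x i))

  funToFin-cong : ∀ {m k} {g h : Fin m → Fin k} → (∀ i → g i ≡ h i) → funToFin g ≡ funToFin h
  funToFin-cong {zero}  g≗h = refl
  funToFin-cong {suc m} g≗h = cong₂ Fin.combine (g≗h zero) (funToFin-cong (g≗h ∘ suc))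

  decode-injective : ∀ m {k l : Fin (q ^ m)} → (∀ i → decode {m} k i ≈ decode {m} l i) → k ≡ l
  decode-injective m {k} {l} p = ≡.trans (≡.sym (Fin.funToFin-finToFin {m} k))
    (≡.trans (funToFin-cong {m} (λ i → ≡.trans (≡.sym (E.strictlyInverseˡ _))
      (≡.trans (E.to-cong (p i)) (E.strictlyInverseˡ _))))
      (Fin.funToFin-finToFin {m} l))

  -- Sending the coefficients of a combination of vs to its coordinates in
  -- ws is an injection from q ^ length vs to q ^ length ws elements.
  independent⇒length≤ : ∀ {vs ws} → LinearlyIndependent vs →
    (∀ {v} → v ∈ vs → Span ws v) → length vs ≤ length ws
  independent⇒length≤ {vs} {ws} ind vs⊆ws = ℕ.≮⇒≥ λ ws<vs →
    ℕ.<⇒≱ (ℕ.^-monoʳ-< q 1<q ws<vs) (Fin.injective⇒≤ g-injective)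
    where
    coords : (x : Vector K (length vs)) → ∃ λ y → linComb y (lookup ws) ≋ linComb x (lookup vs)
    coords x = coordinates (Span-⊆ vs⊆ws (linComb∈Span vs x))

    g : Fin (q ^ length vs) → Fin (q ^ length ws)
    g k = encode (proj₁ (coords (decode k)))

    equal : ∀ x x′ → linComb x (lookup vs) ≋ linComb x′ (lookup vs) → ∀ i → x i ≈ x′ i
    equal x x′ p i = begin
      x i                            ≈⟨ +-identityʳ _ ⟨
      x i ⊕ 0#                       ≈⟨ +-congˡ (-‿inverseˡ (x′ i)) ⟨
      x i ⊕ (- x′ i ⊕ x′ i)          ≈⟨ +-assoc _ _ _ ⟨
      (x i ⊕ - x′ i) ⊕ x′ i          ≈⟨ +-congʳ (+-congˡ (R.-1*x≈-x _)) ⟨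
      (x i ⊕ - 1# ⊗ x′ i) ⊕ x′ i     ≈⟨ +-congʳ (ind _ diff≋0 i) ⟩
      0# ⊕ x′ i                      ≈⟨ +-identityˡ _ ⟩
      x′ i                           ∎
      where
      diff≋0 : linComb (λ i → x i ⊕ - 1# ⊗ x′ i) (lookup vs) ≋ 0ᵥ
      diff≋0 j = begin
        linComb (λ i → x i ⊕ - 1# ⊗ x′ i) (lookup vs) j
          ≈⟨ linComb-+ x _ (lookup vs) j ⟩
        linComb x (lookup vs) j ⊕ linComb (λ i → - 1# ⊗ x′ i) (lookup vs) j
          ≈⟨ +-cong (p j) (linComb-· (- 1#) x′ (lookup vs) j) ⟩
        linComb x′ (lookup vs) j ⊕ - 1# ⊗ linComb x′ (lookup vs) j
          ≈⟨ +-congˡ (R.-1*x≈-x _) ⟩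
        linComb x′ (lookup vs) j ⊕ - linComb x′ (lookup vs) j
          ≈⟨ -‿inverseʳ _ ⟩
        0# ∎

    g-injective : ∀ {k l} → g k ≡ g l → k ≡ l
    g-injective {k} {l} eq = decode-injective (length vs) (equal _ _ λ j → begin
      linComb (decode k) (lookup vs) j
        ≈⟨ proj₂ (coords (decode k)) j ⟨
      linComb (proj₁ (coords (decode k))) (lookup ws) j
        ≈⟨ linComb-cong (lookup ws) same j ⟩
      linComb (proj₁ (coords (decode l))) (lookup ws) j
        ≈⟨ proj₂ (coords (decode l)) j ⟩
      linComb (decode l) (lookup vs) j ∎)
      where
      same : ∀ i → proj₁ (coords (decode k)) i ≈ proj₁ (coords (decode l)) i
      same i = ≈-trans (≈-sym (decode-encode _ i))
        (≈-trans (reflexive (cong (λ e → decode e i) eq)) (decode-encode _ i))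

  data Independent : List V → Set (c ⊔ ℓ) where
    []  : Independent []
    _∷_ : ∀ {v vs} → ¬ Span vs v → Independent vs → Independent (v ∷ vs)

  Independent⇒LinearlyIndependent : ∀ {vs} → Independent vs → LinearlyIndependent vs
  Independent⇒LinearlyIndependent {v ∷ vs} (v∉ ∷ ind) x p = λ where
      zero    → x₀≈0
      (suc i) → Independent⇒LinearlyIndependent ind (x ∘ suc) rest≋0 i
    where
    rest : V
    rest = linComb (x ∘ suc) (lookup vs)

    x₀≈0 : x zero ≈ 0#
    x₀≈0 with x zero ≈? 0#
    ... | yes eq = eq
    ... | no  x₀≉0 with inverse (x zero) x₀≉0
    ...   | y , x₀y≈1 = contradiction
      (resp (λ j → begin
        (- 1# ⊗ (y ⊗ rest j))                        ≈⟨ R.-1*x≈-x _ ⟩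
        - (y ⊗ rest j)                               ≈⟨ +-identityˡ _ ⟨
        0# ⊕ - (y ⊗ rest j)                          ≈⟨ +-congʳ (≈-trans (*-congˡ (p j)) (zeroʳ y)) ⟨
        y ⊗ (x zero ⊗ v j ⊕ rest j) ⊕ - (y ⊗ rest j) ≈⟨ +-congʳ (distribˡ y _ _) ⟩
        (y ⊗ (x zero ⊗ v j) ⊕ y ⊗ rest j) ⊕ - (y ⊗ rest j) ≈⟨ +-assoc _ _ _ ⟩
        y ⊗ (x zero ⊗ v j) ⊕ (y ⊗ rest j ⊕ - (y ⊗ rest j)) ≈⟨ +-congˡ (-‿inverseʳ _) ⟩
        y ⊗ (x zero ⊗ v j) ⊕ 0#                      ≈⟨ +-identityʳ _ ⟩
        y ⊗ (x zero ⊗ v j)                           ≈⟨ *-assoc _ _ _ ⟨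
        (y ⊗ x zero) ⊗ v j                           ≈⟨ *-congʳ (≈-trans (*-comm y _) x₀y≈1) ⟩
        1# ⊗ v j                                     ≈⟨ *-identityˡ _ ⟩
        v j                                          ∎)
        (scale (- 1#) (scale y (linComb∈Span vs (x ∘ suc)))))
      v∉

    rest≋0 : rest ≋ 0ᵥ
    rest≋0 j = begin
      rest j                   ≈⟨ +-identityˡ _ ⟨
      0# ⊕ rest j              ≈⟨ +-congʳ (≈-trans (*-congʳ x₀≈0) (zeroˡ (v j))) ⟨
      x zero ⊗ v j ⊕ rest j    ≈⟨ p j ⟩
      0#                       ∎

  Independent-++ : ∀ ks {bs cs} → Independent (ks ++ bs) →
    (∀ {v} → v ∈ cs → v ∈ bs) → Independent cs → Independent (ks ++ cs)
  Independent-++ []       _          cs⊆bs ind = ind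
  Independent-++ (k ∷ ks) {bs} {cs} (k∉ ∷ ind′) cs⊆bs ind =
    (k∉ ∘ Span-mono (λ v∈ → [ ∈-++⁺ˡ , ∈-++⁺ʳ ks ∘ cs⊆bs ]′ (∈-++⁻ ks v∈)))
    ∷ Independent-++ ks ind′ cs⊆bs ind

  record Extension (gs bs : List V) : Set (c ⊔ ℓ) where
    field
      new         : List V
      new⊆        : ∀ {v} → v ∈ new → v ∈ gs
      independent : Independent (new ++ bs)
      spanning    : ∀ {v} → v ∈ gs → Span (new ++ bs) v
      length-new  : length new ≤ length gs

  extend : ∀ gs {bs} → Independent bs → Extension gs bs
  extend [] ind = record
    { new = [] ; new⊆ = λ () ; independent = ind ; spanning = λ () ; length-new = z≤n }
  extend (g ∷ gs) {bs} ind with extend gs ind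
  ... | ext with Span? (Extension.new ext ++ bs) g
  ...   | yes s = record
    { new         = new
    ; new⊆        = there ∘ new⊆
    ; independent = independent
    ; spanning    = λ { (here refl) → s ; (there v∈) → spanning v∈ }
    ; length-new  = ℕ.m≤n⇒m≤1+n length-new
    }
    where open Extension ext
  ...   | no ¬s = record
    { new         = g ∷ new
    ; new⊆        = λ { (here refl) → here refl ; (there v∈) → there (new⊆ v∈) }
    ; independent = ¬s ∷ independent
    ; spanning    = λ { (here refl) → gen (here refl) ; (there v∈) → Span-mono there (spanning v∈) }
    ; length-new  = s≤s length-new
    }
    where open Extension ext

  basis : (vs : List V) → ∃ λ bs → IsBasis bs (Span vs)
  basis vs = new ++ [] , Independent⇒LinearlyIndependent independent , λ w → mk⇔
    (Span-⊆ spanning)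
    (Span-mono λ v∈ → [ new⊆ , (λ ()) ]′ (∈-++⁻ new v∈))
    where open Extension (extend vs [])

  span-hasDimension : (vs : List V) → ∃ λ d → HasDimension (Span vs) d
  span-hasDimension vs = let bs , isBasis = basis vs in length bs , bs , isBasis , refl

  dim : List V → ℕ
  dim vs = proj₁ (span-hasDimension vs)

  hasDimension-unique : ∀ {p} {W : Pred V p} {d e} → HasDimension W d → HasDimension W e → d ≡ e
  hasDimension-unique (bs , (bs-ind , W⇔bs) , refl) (cs , (cs-ind , W⇔cs) , refl) = ℕ.≤-antisym
    (independent⇒length≤ bs-ind λ v∈ → Equivalence.to (W⇔cs _) (Equivalence.from (W⇔bs _) (gen v∈)))
    (independent⇒length≤ cs-ind λ v∈ → Equivalence.to (W⇔bs _) (Equivalence.from (W⇔cs _) (gen v∈)))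

  dim≤length : ∀ vs → dim vs ≤ length vs
  dim≤length vs = subst (_≤ length vs) (cong length (≡.sym (List.++-identityʳ new))) length-new
    where open Extension (extend vs [])

  independent⇒length≤dim : ∀ {vs ws} → Independent vs → (∀ {v} → v ∈ vs → Span ws v) →
    length vs ≤ dim ws
  independent⇒length≤dim {vs} {ws} ind vs⊆ws =
    let bs , _ , W⇔ = basis ws in
    independent⇒length≤ (Independent⇒LinearlyIndependent ind)
      (λ v∈ → Equivalence.to (W⇔ _) (vs⊆ws v∈))

  dim≤spanning : ∀ {vs ws} → (∀ {v} → v ∈ vs → Span ws v) → dim vs ≤ length ws
  dim≤spanning {vs} vs⊆ws =
    let bs , ind , W⇔ = basis vs in
    independent⇒length≤ ind (λ v∈ → Span-⊆ vs⊆ws (Equivalence.from (W⇔ _) (gen v∈)))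

  dim-mono : ∀ {vs ws} → (∀ {v} → v ∈ vs → v ∈ ws) → dim vs ≤ dim ws
  dim-mono {vs} {ws} vs⊆ws =
    let bs , _ , W⇔ = basis ws in
    dim≤spanning (λ v∈ → Equivalence.to (W⇔ _) (gen (vs⊆ws v∈)))

  dim-submodular : ∀ {vs ws us is} →
    (∀ {v} → v ∈ us → v ∈ vs ⊎ v ∈ ws) → (∀ {v} → v ∈ is → v ∈ vs × v ∈ ws) →
    dim us + dim is ≤ dim vs + dim ws
  dim-submodular {vs} {ws} {us} {is} us⊆ is⊆ = ℕR.begin
    dim us + dim is
      ℕR.≤⟨ ℕ.+-mono-≤ us≤ is≤ ⟩
    (k + (j + i)) + i
      ℕR.≡⟨ cong (_+ i) (ℕ.+-comm k (j + i)) ⟩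
    ((j + i) + k) + i
      ℕR.≡⟨ ℕ.+-assoc (j + i) k i ⟩
    (j + i) + (k + i)
      ℕR.≤⟨ ℕ.+-mono-≤ vs≥ ws≥ ⟩
    dim vs + dim ws
      ℕR.∎
    where
    module ℕR = ℕ.≤-Reasoning
    module I = Extension (extend is {[]} [])
    I : List V
    I = I.new ++ []
    module J = Extension (extend vs I.independent)
    module K′ = Extension (extend ws J.independent)

    i j k : ℕ
    i = length I
    j = length J.new
    k = length K′.new

    I⊆is : ∀ {v} → v ∈ I → v ∈ is
    I⊆is v∈ = [ I.new⊆ , (λ ()) ]′ (∈-++⁻ I.new v∈)

    us≤ : dim us ≤ k + (j + i)
    us≤ = subst (dim us ≤_)
      (≡.trans (List.length-++ K′.new) (cong (k +_) (List.length-++ J.new)))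
      (dim≤spanning λ v∈ →
        [ Span-mono (∈-++⁺ʳ K′.new) ∘ J.spanning , K′.spanning ]′ (us⊆ v∈))

    is≤ : dim is ≤ i
    is≤ = dim≤spanning I.spanning

    vs≥ : j + i ≤ dim vs
    vs≥ = subst (_≤ dim vs) (List.length-++ J.new)
      (independent⇒length≤dim J.independent λ v∈ →
        gen ([ J.new⊆ , proj₁ ∘ is⊆ ∘ I⊆is ]′ (∈-++⁻ J.new v∈)))

    ws≥ : k + i ≤ dim ws
    ws≥ = subst (_≤ dim ws) (List.length-++ K′.new)
      (independent⇒length≤dim
        (Independent-++ K′.new K′.independent (∈-++⁺ʳ J.new) I.independent) λ v∈ →
        gen ([ K′.new⊆ , proj₂ ∘ is⊆ ∘ I⊆is ]′ (∈-++⁻ K′.new v∈)))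

  -- A one-dimensional subspace is given by a nonzero vector spanning it;
  -- two such vectors are the same point when they span the same subspace.
  NonzeroVector : Set (c ⊔ ℓ)
  NonzeroVector = Σ V λ v → ¬ v ≋ 0ᵥ

  line : NonzeroVector → Pred V (c ⊔ ℓ)
  line (v , _) = Span (v ∷ [])

  Points : DecSetoid (c ⊔ ℓ) (c ⊔ ℓ)
  Points = record
    { Carrier          = NonzeroVector
    ; _≈_              = λ s t → ∀ w → line s w ⇔ line t w
    ; isDecEquivalence = record
      { isEquivalence = record
        { refl  = λ w → mk⇔ id id
        ; sym   = λ p w → mk⇔ (Equivalence.from (p w)) (Equivalence.to (p w))
        ; trans = λ p r w → mk⇔ (Equivalence.to (r w) ∘ Equivalence.to (p w))
                                (Equivalence.from (p w) ∘ Equivalence.from (r w))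
        }
      ; _≟_ = λ (u , _) (v , _) → Dec.map′
          (λ (s , t) w → mk⇔ (Span-⊆ (λ { (here refl) → s })) (Span-⊆ (λ { (here refl) → t })))
          (λ p → Equivalence.to (p u) (gen (here refl)) , Equivalence.from (p v) (gen (here refl)))
          (Span? (v ∷ []) u Dec.×-dec Span? (u ∷ []) v)
      }
    }

  nonzero? : V → Maybe NonzeroVector
  nonzero? v with v ≋? 0ᵥ
  ... | yes _   = nothing
  ... | no  v≉0 = just (v , v≉0)

  nonzeroVectors : List NonzeroVector
  nonzeroVectors = mapMaybe (λ k → nonzero? (decode k)) (List.allFin (q ^ n))

  -- One spanning vector for each one-dimensional subspace.
  points : List NonzeroVector
  points = deduplicate (DecSetoid._≟_ Points) nonzeroVectors

  vectors : Subset (length points) → List V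
  vectors A = map proj₁ (select points A)

  points-unique : Unique.Unique (DecSetoid.setoid Points) points
  points-unique = Unique.deduplicate-! Points nonzeroVectors

  points-complete : Enumerates.IsEnumeration (DecSetoid.setoid Points) points
  points-complete = Enumerates.deduplicate⁺ Points λ (v , v≉0) →
    Any.mapMaybe⁺ _ (List.allFin (q ^ n))
      (Any.map⁺ (Any.tabulate⁺ (encode v) (found v v≉0 (λ j → ≈-sym (decode-encode v j)))))
    where
    found : ∀ v v≉0 {w} → v ≋ w →
      Maybe.Any (λ t → DecSetoid._≈_ Points (v , v≉0) t) (nonzero? w)
    found v v≉0 {w} v≋w with w ≋? 0ᵥ
    ... | yes w≋0 = contradiction (λ j → ≈-trans (v≋w j) (w≋0 j)) v≉0
    ... | no  _   = Maybe.just λ u → mk⇔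
      (Span-⊆ (λ { (here refl) → resp (λ j → ≈-sym (v≋w j)) (gen (here refl)) }))
      (Span-⊆ (λ { (here refl) → resp v≋w (gen (here refl)) }))

-- PG(n-1,q): here n is the dimension of the vector space, not of the projective space.
PG : FiniteField c ℓ q → ℕ → Matroid
PG F n = record
  { size       = length points
  ; rank       = λ A → dim (vectors A)
  ; rank≤∣∣    = λ A → ℕ.≤-trans (dim≤length (vectors A)) (ℕ.≤-reflexive
      (≡.trans (List.length-map proj₁ (select points A)) (length-select points A)))
  ; rank-mono  = λ A B A⊆B → dim-mono (map⊆ (select-mono points A B A⊆B))
  ; submodular = λ A B → dim-submodular {vs = vectors A} {ws = vectors B}
      (λ v∈ → let s , s∈ , eq = ∈-map⁻ proj₁ v∈ in
        Data.Sum.Base.map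
          (λ t → subst (_∈ vectors A) (≡.sym eq) (∈-map⁺ proj₁ t))
          (λ t → subst (_∈ vectors B) (≡.sym eq) (∈-map⁺ proj₁ t))
          (select-∪ points A B s∈))
      (λ v∈ →
        map⊆ (select-mono points (A ∩ B) A (Subset.p∩q⊆p A B)) v∈ ,
        map⊆ (select-mono points (A ∩ B) B (Subset.p∩q⊆q A B)) v∈)
  }
  where
  open LinearAlgebra F n

  map⊆ : ∀ {ss ts : List NonzeroVector} → (∀ {s} → s ∈ ss → s ∈ ts) →
    ∀ {v} → v ∈ map proj₁ ss → v ∈ map proj₁ ts
  map⊆ h v∈ = let s , s∈ , eq = ∈-map⁻ proj₁ v∈ in
    subst (_∈ _) (≡.sym eq) (∈-map⁺ proj₁ (h s∈))

{-# OPTIONS --safe #-}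

-- A set A of fewer than q ^ (n ∸ 1) points has a spanning complement: a
-- complement that does not span lies in a hyperplane, so A contains the
-- q ^ (n ∸ 1) points off it. Such an A therefore has dual rank ∣ A ∣, and by
-- monotonicity every larger set has dual rank at least k = q ^ (n ∸ 1) ∸ 1.
-- So for i < k the sets of dual rank i are exactly the N C i sets of size i.
--
-- The points of ⟨b, bs⟩ off ⟨bs⟩ correspond to the vectors w of ⟨bs⟩ through the
-- line spanned by b + w, which gives N = 1 + q + … + q ^ (n ∸ 1) by induction.
module Submission where

open import Defs
import Algebra.Properties.Ring
open import Data.Bool.Base using (true; false)
open import Data.Fin.Base using (Fin; zero; suc)
import Data.Fin.Properties as Fin
open import Data.Fin.Subset using (Subset; inside; outside; ∣_∣; ∁; _⊆_; ⊤)
open import Data.Fin.Subset.Properties using (⊆-max; ∣⊤∣≡n; out⊆; in⊆in)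
open import Data.Integer.Base using (ℤ; +_; 0ℤ; 1ℤ; -1ℤ) renaming (_+_ to _+ℤ_; _*_ to _*ℤ_; _^_ to _^ℤ_)
import Data.Integer.Properties as ℤ
open import Data.List.Base using (List; []; _∷_; _++_; map; length; filter; lookup)
open import Data.List.Membership.Propositional using (_∈_; find; lose)
open import Data.List.Membership.Propositional.Properties using (∈-map⁺; ∈-map⁻; ∈-++⁺ʳ; ∈-lookup; ∈-filter⁻)
import Data.List.Membership.Setoid as SetoidMembership
open import Data.List.Membership.Setoid.Properties using (index-injective; ∈-filter⁺)
open import Data.List.Properties using (map-++; map-∘; filter-all; filter-none)
open import Data.List.Relation.Unary.All as All using ()
open import Data.List.Relation.Unary.AllPairs using (_∷_)
open import Data.List.Relation.Unary.Any using (here; there)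
open import Data.List.Relation.Unary.Unique.Setoid using (Unique)
import Data.List.Relation.Unary.Unique.Setoid.Properties as Unique
open import Data.Nat.Base
  using (ℕ; zero; suc; _+_; _*_; _∸_; _^_; _/_; _≤_; _<_; z≤n; s≤s; s≤s⁻¹; NonZero; ≢-nonZero⁻¹; >-nonZero)
open import Data.Nat.Combinatorics using (_C_; nCk+nC[k+1]≡[n+1]C[k+1])
open import Data.Nat.DivMod using (m*n/n≡m)
import Data.Nat.Properties as ℕ
open import Data.Product.Base using (_×_; _,_; ∃; proj₁; proj₂)
open import Data.Sum.Base as Sum using (_⊎_; inj₁; inj₂)
open import Data.Vec.Base using ([]; _∷_)
open import Data.Vec.Functional as Vector using (Vector)
open import Function.Base using (_∘_; id)
open import Function.Bundles using (mk⇔; Equivalence)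
open import Relation.Binary.Bundles using (Setoid; DecSetoid)
open import Relation.Binary.PropositionalEquality
  using (_≡_; _≢_; refl; sym; trans; cong; cong₂; subst; module ≡-Reasoning)
open import Relation.Nullary using (¬_; contradiction; yes; no)
import Relation.Nullary.Decidable as Dec
open import Relation.Unary using (Pred; Decidable)

-- Coefficients of sums of monomials.

coeff-+ₚ : ∀ p r d → coeff (p +ₚ r) d ≡ coeff p d +ℤ coeff r d
coeff-+ₚ []      r       d       = sym (ℤ.+-identityˡ (coeff r d))
coeff-+ₚ (a ∷ p) []      d       = sym (ℤ.+-identityʳ (coeff (a ∷ p) d))
coeff-+ₚ (a ∷ p) (b ∷ r) zero    = refl
coeff-+ₚ (a ∷ p) (b ∷ r) (suc d) = coeff-+ₚ p r d

coeff-monomial-≡ : ∀ a d → coeff (monomial a d) d ≡ a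
coeff-monomial-≡ a zero    = refl
coeff-monomial-≡ a (suc d) = coeff-monomial-≡ a d

coeff-monomial-≢ : ∀ a {d e} → d ≢ e → coeff (monomial a d) e ≡ 0ℤ
coeff-monomial-≢ a {zero}  {zero}  d≢e = contradiction refl d≢e
coeff-monomial-≢ a {zero}  {suc e} d≢e = refl
coeff-monomial-≢ a {suc d} {zero}  d≢e = refl
coeff-monomial-≢ a {suc d} {suc e} d≢e = coeff-monomial-≢ a (d≢e ∘ cong suc)

coeff-monomial-* : ∀ b a d e → coeff (monomial (b *ℤ a) d) e ≡ b *ℤ coeff (monomial a d) e
coeff-monomial-* b a zero    zero    = refl
coeff-monomial-* b a zero    (suc e) = sym (ℤ.*-zeroʳ b)
coeff-monomial-* b a (suc d) zero    = sym (ℤ.*-zeroʳ b)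
coeff-monomial-* b a (suc d) (suc e) = coeff-monomial-* b a d e

coeff-sumₚ-++ : ∀ ps rs d → coeff (sumₚ (ps ++ rs)) d ≡ coeff (sumₚ ps) d +ℤ coeff (sumₚ rs) d
coeff-sumₚ-++ []       rs d = sym (ℤ.+-identityˡ _)
coeff-sumₚ-++ (p ∷ ps) rs d = begin
  coeff (p +ₚ sumₚ (ps ++ rs)) d
    ≡⟨ coeff-+ₚ p _ d ⟩
  coeff p d +ℤ coeff (sumₚ (ps ++ rs)) d
    ≡⟨ cong (coeff p d +ℤ_) (coeff-sumₚ-++ ps rs d) ⟩
  coeff p d +ℤ (coeff (sumₚ ps) d +ℤ coeff (sumₚ rs) d)
    ≡⟨ ℤ.+-assoc (coeff p d) _ _ ⟨
  coeff p d +ℤ coeff (sumₚ ps) d +ℤ coeff (sumₚ rs) d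
    ≡⟨ cong (_+ℤ coeff (sumₚ rs) d) (coeff-+ₚ p _ d) ⟨
  coeff (p +ₚ sumₚ ps) d +ℤ coeff (sumₚ rs) d ∎
  where open ≡-Reasoning

-- Factor and degrees are kept free to serve three purposes: `b = 0ℤ` with empty `g` for vanishing,
-- `b = -1ℤ` with `d = suc e` for a degree shift, and `b = 1ℤ` for termwise comparison.
coeff-sumₚ-map : ∀ {a} {X : Set a} (f g : X → Polynomial) b d e →
  (∀ x → coeff (f x) d ≡ b *ℤ coeff (g x) e) →
  ∀ xs → coeff (sumₚ (map f xs)) d ≡ b *ℤ coeff (sumₚ (map g xs)) e
coeff-sumₚ-map f g b d e f≡bg []       = sym (ℤ.*-zeroʳ b)
coeff-sumₚ-map f g b d e f≡bg (x ∷ xs) = begin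
  coeff (f x +ₚ sumₚ (map f xs)) d
    ≡⟨ coeff-+ₚ (f x) _ d ⟩
  coeff (f x) d +ℤ coeff (sumₚ (map f xs)) d
    ≡⟨ cong₂ _+ℤ_ (f≡bg x) (coeff-sumₚ-map f g b d e f≡bg xs) ⟩
  b *ℤ coeff (g x) e +ℤ b *ℤ coeff (sumₚ (map g xs)) e
    ≡⟨ ℤ.*-distribˡ-+ b _ _ ⟨
  b *ℤ (coeff (g x) e +ℤ coeff (sumₚ (map g xs)) e)
    ≡⟨ cong (b *ℤ_) (coeff-+ₚ (g x) _ e) ⟨
  b *ℤ coeff (g x +ₚ sumₚ (map g xs)) e ∎
  where open ≡-Reasoning

-- Signed enumeration of subsets by size.

signedSize : ∀ {m} → Subset m → Polynomial
signedSize A = monomial (-1ℤ ^ℤ ∣ A ∣) ∣ A ∣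

coeff-signedSizes-suc : ∀ m i →
  coeff (sumₚ (map signedSize (allSubsets (suc m)))) i ≡
  coeff (sumₚ (map signedSize (allSubsets m))) i +ℤ
  coeff (sumₚ (map (signedSize ∘ (inside ∷_)) (allSubsets m))) i
coeff-signedSizes-suc m i = begin
  coeff (sumₚ (map signedSize (map (outside ∷_) (allSubsets m) ++ map (inside ∷_) (allSubsets m)))) i
    ≡⟨ cong (λ ps → coeff (sumₚ ps) i) (map-++ signedSize (map (outside ∷_) (allSubsets m)) _) ⟩
  coeff (sumₚ (map signedSize (map (outside ∷_) (allSubsets m)) ++
               map signedSize (map (inside ∷_) (allSubsets m)))) i
    ≡⟨ cong₂ (λ ps rs → coeff (sumₚ (ps ++ rs)) i) (map-∘ (allSubsets m)) (map-∘ (allSubsets m)) ⟨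
  coeff (sumₚ (map signedSize (allSubsets m) ++ map (signedSize ∘ (inside ∷_)) (allSubsets m))) i
    ≡⟨ coeff-sumₚ-++ (map signedSize (allSubsets m)) _ i ⟩
  _ ∎
  where open ≡-Reasoning

-- The sum is the expansion of (1 - x)^m. Subsets containing the first element contribute -x times
-- the sum for `m`, so the coefficients obey Pascal's rule with alternating signs.
coeff-signedSizes : ∀ m i →
  coeff (sumₚ (map signedSize (allSubsets m))) i ≡ -1ℤ ^ℤ i *ℤ + (m C i)
coeff-signedSizes zero    zero    = refl
coeff-signedSizes zero    (suc i) = sym (ℤ.*-zeroʳ (-1ℤ ^ℤ suc i))
coeff-signedSizes (suc m) zero    = begin
  coeff (sumₚ (map signedSize (allSubsets (suc m)))) 0
    ≡⟨ coeff-signedSizes-suc m 0 ⟩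
  coeff (sumₚ (map signedSize (allSubsets m))) 0 +ℤ
  coeff (sumₚ (map (signedSize ∘ (inside ∷_)) (allSubsets m))) 0
    -- A subset containing the first element has positive size, so its monomial has no constant
    -- term.
    ≡⟨ cong₂ _+ℤ_ (coeff-signedSizes m 0)
         (coeff-sumₚ-map _ (λ _ → []) 0ℤ 0 0 (λ _ → refl) (allSubsets m)) ⟩
  1ℤ *ℤ + (m C 0) +ℤ 0ℤ
    ≡⟨ ℤ.+-identityʳ _ ⟩
  1ℤ *ℤ + (m C 0)
    ≡⟨⟩
  1ℤ *ℤ + (suc m C 0) ∎
  where open ≡-Reasoning
coeff-signedSizes (suc m) (suc i) = begin
  coeff (sumₚ (map signedSize (allSubsets (suc m)))) (suc i)
    ≡⟨ coeff-signedSizes-suc m (suc i) ⟩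
  coeff (sumₚ (map signedSize (allSubsets m))) (suc i) +ℤ
  coeff (sumₚ (map (signedSize ∘ (inside ∷_)) (allSubsets m))) (suc i)
    ≡⟨ cong₂ _+ℤ_ (coeff-signedSizes m (suc i))
         (trans
           (coeff-sumₚ-map _ signedSize -1ℤ (suc i) i
             (λ A → coeff-monomial-* -1ℤ (-1ℤ ^ℤ ∣ A ∣) ∣ A ∣ i) (allSubsets m))
           (cong (-1ℤ *ℤ_) (coeff-signedSizes m i))) ⟩
  s *ℤ + (m C suc i) +ℤ -1ℤ *ℤ (-1ℤ ^ℤ i *ℤ + (m C i))
    ≡⟨ cong (s *ℤ + (m C suc i) +ℤ_) (ℤ.*-assoc -1ℤ (-1ℤ ^ℤ i) _) ⟨
  s *ℤ + (m C suc i) +ℤ s *ℤ + (m C i)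
    ≡⟨ ℤ.*-distribˡ-+ s _ _ ⟨
  s *ℤ + (m C suc i + m C i)
    ≡⟨ cong (λ c → s *ℤ + c) (trans (ℕ.+-comm (m C suc i) _) (nCk+nC[k+1]≡[n+1]C[k+1] m i)) ⟩
  s *ℤ + (suc m C suc i) ∎
  where
  open ≡-Reasoning
  s : ℤ
  s = -1ℤ ^ℤ suc i

-- Matroids in which all small sets are independent.

subset-of-size : ∀ {m} (A : Subset m) {k} → k ≤ ∣ A ∣ → ∃ λ B → B ⊆ A × ∣ B ∣ ≡ k
subset-of-size []          {zero}  _    = [] , (λ x∈ → x∈) , refl
subset-of-size (false ∷ A) k≤ with subset-of-size A k≤
... | B , B⊆A , eq = outside ∷ B , out⊆ B⊆A , eq
subset-of-size (true ∷ A)  {zero}  _    with subset-of-size A z≤n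
... | B , B⊆A , eq = outside ∷ B , out⊆ B⊆A , eq
subset-of-size (true ∷ A)  {suc k} k<   with subset-of-size A (s≤s⁻¹ k<)
... | B , B⊆A , eq = inside ∷ B , in⊆in B⊆A , cong suc eq

module _ (M : Matroid) where
  open Matroid M

  -- Each exponent is `rank ⊤` minus something, hence at most `rank ⊤`.
  coeff-degree> : ∀ d → rank ⊤ < d → coeff (characteristicPolynomial M) d ≡ 0ℤ
  coeff-degree> d r<d = coeff-sumₚ-map _ (λ _ → []) 0ℤ d d
    (λ A → coeff-monomial-≢ _ (ℕ.<⇒≢ (ℕ.≤-<-trans (ℕ.m∸n≤m (rank ⊤) (rank A)) r<d)))
    (allSubsets size)

  module _ {k} (small-independent : ∀ A → ∣ A ∣ ≤ k → rank A ≡ ∣ A ∣) where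

    -- Shrinking `A` to exactly `k` elements gives an independent set, and rank is monotone.
    k≤rank : ∀ A → k ≤ ∣ A ∣ → k ≤ rank A
    k≤rank A k≤∣A∣ with subset-of-size A k≤∣A∣
    ... | B , B⊆A , refl =
      subst (_≤ rank A) (small-independent B ℕ.≤-refl) (rank-mono B A B⊆A)

    rank≢⇒∣∣≢ : ∀ {i} → i < k → ∀ A → rank A ≢ i → ∣ A ∣ ≢ i
    rank≢⇒∣∣≢ i<k A rA≢i refl = rA≢i (small-independent A (ℕ.<⇒≤ i<k))

    rank≡⇒∣∣≡ : ∀ {i} → i < k → ∀ A → rank A ≡ i → ∣ A ∣ ≡ i
    rank≡⇒∣∣≡ i<k A refl with ℕ.≤-total ∣ A ∣ k
    ... | inj₁ ∣A∣≤k = sym (small-independent A ∣A∣≤k)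
    ... | inj₂ k≤∣A∣ = contradiction i<k (ℕ.≤⇒≯ (k≤rank A k≤∣A∣))

    -- Below `k`, rank `i` and size `i` are the same condition. Hence the terms of degree
    -- `rank ⊤ ∸ i` match those of degree `i` in the signed enumeration by size.
    coeff-top : k ≤ size → ∀ i → i < k →
      coeff (characteristicPolynomial M) (rank ⊤ ∸ i) ≡ -1ℤ ^ℤ i *ℤ + (size C i)
    coeff-top k≤size i i<k = begin
      coeff (characteristicPolynomial M) (rank ⊤ ∸ i)
        ≡⟨ coeff-sumₚ-map _ signedSize 1ℤ (rank ⊤ ∸ i) i termwise (allSubsets size) ⟩
      1ℤ *ℤ coeff (sumₚ (map signedSize (allSubsets size))) i
        ≡⟨ ℤ.*-identityˡ _ ⟩
      coeff (sumₚ (map signedSize (allSubsets size))) i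
        ≡⟨ coeff-signedSizes size i ⟩
      -1ℤ ^ℤ i *ℤ + (size C i) ∎
      where
      open ≡-Reasoning

      i≤rank⊤ : i ≤ rank ⊤
      i≤rank⊤ = ℕ.≤-trans (ℕ.<⇒≤ i<k) (k≤rank ⊤ (subst (k ≤_) (sym (∣⊤∣≡n size)) k≤size))

      termwise : ∀ A →
        coeff (monomial (-1ℤ ^ℤ ∣ A ∣) (rank ⊤ ∸ rank A)) (rank ⊤ ∸ i) ≡ 1ℤ *ℤ coeff (signedSize A) i
      termwise A with rank A ℕ.≟ i
      ... | yes refl = begin
        coeff (monomial a (rank ⊤ ∸ rank A)) (rank ⊤ ∸ rank A)  ≡⟨ coeff-monomial-≡ a (rank ⊤ ∸ rank A) ⟩
        a                                                       ≡⟨ coeff-monomial-≡ a ∣ A ∣ ⟨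
        coeff (signedSize A) ∣ A ∣                              ≡⟨ cong (coeff (signedSize A)) (rank≡⇒∣∣≡ i<k A refl) ⟩
        coeff (signedSize A) (rank A)                           ≡⟨ ℤ.*-identityˡ _ ⟨
        1ℤ *ℤ coeff (signedSize A) (rank A)                     ∎
        where
        a : ℤ
        a = -1ℤ ^ℤ ∣ A ∣
      ... | no rA≢i = begin
        coeff (monomial (-1ℤ ^ℤ ∣ A ∣) (rank ⊤ ∸ rank A)) (rank ⊤ ∸ i)
          -- Both `rank A` and `i` are at most `rank ⊤`, so truncated subtraction from it is
          -- injective on them.
          ≡⟨ coeff-monomial-≢ _ (rA≢i ∘ ℕ.∸-cancelˡ-≡ (rank-mono A ⊤ (⊆-max A)) i≤rank⊤) ⟩
        0ℤ
          ≡⟨ cong (1ℤ *ℤ_) (coeff-monomial-≢ _ (rank≢⇒∣∣≢ i<k A rA≢i)) ⟨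
        1ℤ *ℤ coeff (signedSize A) i ∎

-- Counting list elements up to equivalence.

module _ {a ℓ} (S : Setoid a ℓ) where
  open Setoid S using (Carrier; _≈_) renaming (sym to ≈-sym; trans to ≈-trans)
  open SetoidMembership S using () renaming (_∈_ to _∈ₛ_)

  injective⇒≤length : ∀ {m} (f : Fin m → Carrier) {xs} →
    (∀ {i j} → f i ≈ f j → i ≡ j) → (∀ i → f i ∈ₛ xs) → m ≤ length xs
  injective⇒≤length f f-injective f∈ =
    Fin.injective⇒≤ (f-injective ∘ index-injective S (f∈ _) (f∈ _))

  lookup-injective : ∀ {xs} → Unique S xs → ∀ {i j} → lookup xs i ≈ lookup xs j → i ≡ j
  lookup-injective (x∉ ∷ xs!) {zero}  {zero}  _  = refl
  lookup-injective (x∉ ∷ xs!) {zero}  {suc j} eq = contradiction eq (All.lookup x∉ (∈-lookup j))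
  lookup-injective (x∉ ∷ xs!) {suc i} {zero}  eq = contradiction (≈-sym eq) (All.lookup x∉ (∈-lookup i))
  lookup-injective (x∉ ∷ xs!) {suc i} {suc j} eq = cong suc (lookup-injective xs! eq)

  -- Choose a preimage for each position of `xs`. Positions with equal preimages hold equivalent
  -- elements, so uniqueness makes the choice injective.
  surjective⇒length≤ : ∀ {m} (f : Fin m → Carrier) {xs} → Unique S xs →
    (∀ {x} → x ∈ xs → ∃ λ i → f i ≈ x) → length xs ≤ m
  surjective⇒length≤ f {xs} xs! surj = Fin.injective⇒≤ g-injective
    where
    g : Fin (length xs) → Fin _
    g i = proj₁ (surj (∈-lookup i))

    g-injective : ∀ {i j} → g i ≡ g j → i ≡ j
    g-injective {i} {j} eq = lookup-injective xs! (≈-trans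
      (≈-sym (proj₂ (surj (∈-lookup i))))
      (subst (λ k → f k ≈ lookup xs j) (sym eq) (proj₂ (surj (∈-lookup j)))))

length-filter-split : ∀ {a p r} {X : Set a} {P : Pred X p} {R : Pred X r}
  (P? : Decidable P) (R? : Decidable R) → (∀ {x} → P x → R x) → ∀ xs →
  length (filter R? xs) ≡
  length (filter P? xs) + length (filter (λ x → R? x Dec.×-dec Dec.¬? (P? x)) xs)
length-filter-split P? R? P⇒R []       = refl
length-filter-split P? R? P⇒R (x ∷ xs) with P? x | R? x
... | yes px | yes rx = cong suc (length-filter-split P? R? P⇒R xs)
... | yes px | no ¬rx = contradiction (P⇒R px) ¬rx
... | no ¬px | yes rx = trans (cong suc (length-filter-split P? R? P⇒R xs)) (sym (ℕ.+-suc _ _))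
... | no ¬px | no ¬rx = length-filter-split P? R? P⇒R xs

select-∁ : ∀ {a} {X : Set a} (xs : List X) A {x} → x ∈ xs →
  x ∈ select xs A ⊎ x ∈ select xs (∁ A)
select-∁ (x ∷ xs) (true  ∷ A) (here eq)  = inj₁ (here eq)
select-∁ (x ∷ xs) (false ∷ A) (here eq)  = inj₂ (here eq)
select-∁ (x ∷ xs) (true  ∷ A) (there x∈) = Sum.map₁ there (select-∁ xs A x∈)
select-∁ (x ∷ xs) (false ∷ A) (there x∈) = Sum.map₂ there (select-∁ xs A x∈)

-- The highest power is added last, to match the `q ^ d` points gained when a subspace of dimension
-- `d` grows by one dimension.
geometricSum : ℕ → ℕ → ℕ
geometricSum q zero    = 0
geometricSum q (suc d) = geometricSum q d + q ^ d

-- Writing `q` as `suc r` avoids truncated subtraction in the closed form.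
suc-geometricSum : ∀ r d → suc (geometricSum (suc r) d * r) ≡ suc r ^ d
suc-geometricSum r zero    = refl
suc-geometricSum r (suc d) = begin
  suc ((geometricSum (suc r) d + suc r ^ d) * r)
    ≡⟨ cong suc (ℕ.*-distribʳ-+ r (geometricSum (suc r) d) _) ⟩
  suc (geometricSum (suc r) d * r) + suc r ^ d * r
    ≡⟨ cong₂ _+_ (suc-geometricSum r d) (ℕ.*-comm (suc r ^ d) r) ⟩
  suc r ^ suc d ∎
  where open ≡-Reasoning

-- Bases and coordinates over a finite field.

module PointCounting {c ℓ q} (F : FiniteField c ℓ q) (n : ℕ) where
  open LinearAlgebra F n
  open FiniteField F
    hiding (zero)
    renaming (Carrier to K; _+_ to _⊕_; _*_ to _⊗_; refl to ≈-refl; sym to ≈-sym; trans to ≈-trans)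
  open import Relation.Binary.Reasoning.Setoid setoid
  private
    module R = Algebra.Properties.Ring ring
    module P = DecSetoid Points

  open SetoidMembership P.setoid using () renaming (_∈_ to _∈ₚ_)

  coordinates-unique : ∀ vs → LinearlyIndependent vs → ∀ x y →
    linComb x (lookup vs) ≋ linComb y (lookup vs) → ∀ i → x i ≈ y i
  coordinates-unique vs ind x y x≋y i = R.x∙y⁻¹≈ε⇒x≈y _ _ (begin
    x i ⊕ - y i          ≈⟨ +-congˡ (R.-1*x≈-x (y i)) ⟨
    x i ⊕ - 1# ⊗ y i     ≈⟨ ind (λ i → x i ⊕ - 1# ⊗ y i) difference i ⟩
    0#                   ∎)
    where
    difference : linComb (λ i → x i ⊕ - 1# ⊗ y i) (lookup vs) ≋ 0ᵥ
    difference j = begin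
      linComb (λ i → x i ⊕ - 1# ⊗ y i) (lookup vs) j
        ≈⟨ linComb-+ x _ (lookup vs) j ⟩
      linComb x (lookup vs) j ⊕ linComb (λ i → - 1# ⊗ y i) (lookup vs) j
        ≈⟨ +-cong (x≋y j) (linComb-· (- 1#) y (lookup vs) j) ⟩
      linComb y (lookup vs) j ⊕ - 1# ⊗ linComb y (lookup vs) j
        ≈⟨ +-congˡ (R.-1*x≈-x _) ⟩
      linComb y (lookup vs) j ⊕ - linComb y (lookup vs) j
        ≈⟨ -‿inverseʳ _ ⟩
      0# ∎

  encode-injective : ∀ {m} {x y : Vector K m} → encode x ≡ encode y → ∀ i → x i ≈ y i
  encode-injective {m} {x} {y} eq i = ≈-trans (≈-sym (decode-encode x i))
    (≈-trans (reflexive (cong (λ k → decode {m} k i) eq)) (decode-encode y i))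

  -- A comparison of cardinalities: independence makes coefficients to vectors injective, spanning
  -- makes vectors to coefficients injective, and `q ^_` is strictly increasing.
  basis-length : ∀ {vs} → LinearlyIndependent vs → (∀ w → Span vs w) → length vs ≡ n
  basis-length {vs} ind spanning = ℕ.≤-antisym
    (^-cancelʳ-≤ (Fin.injective⇒≤ toVector-injective))
    (^-cancelʳ-≤ (Fin.injective⇒≤ fromVector-injective))
    where
    ^-cancelʳ-≤ : ∀ {d e} → q ^ d ≤ q ^ e → d ≤ e
    ^-cancelʳ-≤ q^d≤q^e = ℕ.≮⇒≥ (λ e<d → ℕ.<⇒≱ (ℕ.^-monoʳ-< q 1<q e<d) q^d≤q^e)

    toVector : Fin (q ^ length vs) → Fin (q ^ n)
    toVector k = encode (linComb (decode {length vs} k) (lookup vs))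

    toVector-injective : ∀ {k l} → toVector k ≡ toVector l → k ≡ l
    toVector-injective {k} {l} eq =
      decode-injective (length vs) (coordinates-unique vs ind (decode k) (decode l) (encode-injective eq))

    fromVector : Fin (q ^ n) → Fin (q ^ length vs)
    fromVector k = encode (proj₁ (coordinates (spanning (decode {n} k))))

    fromVector-injective : ∀ {k l} → fromVector k ≡ fromVector l → k ≡ l
    fromVector-injective {k} {l} eq = decode-injective n λ j → begin
      decode {n} k j
        ≈⟨ proj₂ (coordinates (spanning (decode {n} k))) j ⟨
      linComb (proj₁ (coordinates (spanning (decode {n} k)))) (lookup vs) j
        ≈⟨ linComb-cong (lookup vs) (encode-injective eq) j ⟩
      linComb (proj₁ (coordinates (spanning (decode {n} l)))) (lookup vs) j
        ≈⟨ proj₂ (coordinates (spanning (decode {n} l))) j ⟩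
      decode {n} l j ∎

  InSpan : List V → NonzeroVector → Set _
  InSpan vs (v , _) = Span vs v

  InSpan? : ∀ vs → Decidable (InSpan vs)
  InSpan? vs (v , _) = Span? vs v

  InSpan-resp : ∀ vs {s t} → s P.≈ t → InSpan vs s → InSpan vs t
  InSpan-resp vs {_} {t , _} s≈t s∈ =
    Span-⊆ (λ { (here refl) → s∈ }) (Equivalence.from (s≈t t) (gen (here refl)))

  -- Points of a subspace off a hyperplane of it.

  module Affine {b bs} (b∉ : ¬ Span bs b) (ind : Independent bs) where

    -- The vector `b` is given coefficient `1#` inside one combination over `b ∷ bs`, so that
    -- uniqueness of coordinates applies directly.
    translate : Vector K (length bs) → V
    translate x = linComb (1# Vector.∷ x) (lookup (b ∷ bs))

    translate∈ : ∀ x → Span (b ∷ bs) (translate x)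
    translate∈ x = linComb∈Span (b ∷ bs) (1# Vector.∷ x)

    -- Subtracting the part of the translate in the span of `bs` would leave `b` in that span.
    translate∉ : ∀ x → ¬ Span bs (translate x)
    translate∉ x t∈ = b∉ (resp
      (λ j → begin
        translate x j ⊕ - 1# ⊗ w j       ≈⟨ +-cong (+-congʳ (*-identityˡ (b j))) (R.-1*x≈-x (w j)) ⟩
        (b j ⊕ w j) ⊕ - w j              ≈⟨ +-assoc _ _ _ ⟩
        b j ⊕ (w j ⊕ - w j)              ≈⟨ +-congˡ (-‿inverseʳ (w j)) ⟩
        b j ⊕ 0#                         ≈⟨ +-identityʳ (b j) ⟩
        b j                              ∎)
      (add t∈ (scale (- 1#) (linComb∈Span bs x))))
      where
      w : V
      w = linComb x (lookup bs)

    point : Fin (q ^ length bs) → NonzeroVector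
    point k = translate (decode k) , λ t≋0 →
      translate∉ (decode k) (resp (λ j → ≈-sym (t≋0 j)) zero)

    -- If the lines agree, one translate is a multiple of the other. Both have `b`-coordinate `1#`,
    -- so the multiplier is `1#`.
    point-injective : ∀ {k l} → point k P.≈ point l → k ≡ l
    point-injective {k} {l} k≈l
      with coordinates (Equivalence.to (k≈l (translate (decode k))) (gen (here refl)))
    ... | z , p = decode-injective (length bs) λ i → begin
      decode k i                 ≈⟨ same (suc i) ⟩
      z zero ⊗ decode l i        ≈⟨ *-congʳ (≈-trans (≈-sym (*-identityʳ (z zero))) (≈-sym (same zero))) ⟩
      1# ⊗ decode l i            ≈⟨ *-identityˡ _ ⟩
      decode l i                 ∎
      where
      same : ∀ i → (1# Vector.∷ decode k) i ≈ z zero ⊗ (1# Vector.∷ decode l) i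
      same = coordinates-unique (b ∷ bs) (Independent⇒LinearlyIndependent (b∉ ∷ ind))
        (1# Vector.∷ decode k) (λ i → z zero ⊗ (1# Vector.∷ decode l) i) λ j → begin
        translate (decode k) j
          ≈⟨ p j ⟨
        -- A combination of the single generator of the line, whose sum ends in `0#`.
        z zero ⊗ translate (decode l) j ⊕ 0#
          ≈⟨ +-identityʳ _ ⟩
        z zero ⊗ translate (decode l) j
          ≈⟨ linComb-· (z zero) (1# Vector.∷ decode l) (lookup (b ∷ bs)) j ⟨
        linComb (λ i → z zero ⊗ (1# Vector.∷ decode l) i) (lookup (b ∷ bs)) j ∎

    -- A vector off the span of `bs` has nonzero `b`-coordinate; dividing by it normalises that
    -- coordinate to `1#`.
    point-surjective : ∀ t → InSpan (b ∷ bs) t → ¬ InSpan bs t → ∃ λ k → point k P.≈ t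
    point-surjective (v , _) v∈ v∉ with coordinates v∈
    ... | x , x≋v with x zero ≈? 0#
    ...   | yes x₀≈0 = contradiction
      (resp (λ j → begin
        linComb (x ∘ suc) (lookup bs) j                   ≈⟨ +-identityˡ _ ⟨
        0# ⊕ linComb (x ∘ suc) (lookup bs) j              ≈⟨ +-congʳ (≈-trans (*-congʳ x₀≈0) (zeroˡ (b j))) ⟨
        x zero ⊗ b j ⊕ linComb (x ∘ suc) (lookup bs) j    ≈⟨ x≋v j ⟩
        v j                                               ∎)
        (linComb∈Span bs (x ∘ suc)))
      v∉
    ...   | no x₀≉0 with inverse (x zero) x₀≉0
    ...     | y , x₀y≈1 = k , λ _ → mk⇔
      (Span-⊆ (λ { (here refl) → resp yv≋t (scale y (gen (here refl))) }))
      (Span-⊆ (λ { (here refl) → resp x₀t≋v (scale (x zero) (gen (here refl))) }))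
      where
      z : Vector K (length bs)
      z i = y ⊗ x (suc i)

      k : Fin (q ^ length bs)
      k = encode z

      scaled : ∀ i → y ⊗ x i ≈ (1# Vector.∷ decode k) i
      scaled zero    = ≈-trans (*-comm y (x zero)) x₀y≈1
      scaled (suc i) = ≈-sym (decode-encode z i)

      yv≋t : y ·ᵥ v ≋ translate (decode k)
      yv≋t j = begin
        y ⊗ v j                                       ≈⟨ *-congˡ (x≋v j) ⟨
        y ⊗ linComb x (lookup (b ∷ bs)) j             ≈⟨ linComb-· y x (lookup (b ∷ bs)) j ⟨
        linComb (λ i → y ⊗ x i) (lookup (b ∷ bs)) j   ≈⟨ linComb-cong (lookup (b ∷ bs)) scaled j ⟩
        translate (decode k) j                        ∎

      x₀t≋v : x zero ·ᵥ translate (decode k) ≋ v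
      x₀t≋v j = begin
        x zero ⊗ translate (decode k) j   ≈⟨ *-congˡ (yv≋t j) ⟨
        x zero ⊗ (y ⊗ v j)                ≈⟨ *-assoc _ _ _ ⟨
        (x zero ⊗ y) ⊗ v j                ≈⟨ *-congʳ x₀y≈1 ⟩
        1# ⊗ v j                          ≈⟨ *-identityˡ (v j) ⟩
        v j                               ∎

    offSpan? : Decidable (λ t → InSpan (b ∷ bs) t × ¬ InSpan bs t)
    offSpan? t = InSpan? (b ∷ bs) t Dec.×-dec Dec.¬? (InSpan? bs t)

    offSpan-resp : ∀ {s t} → s P.≈ t →
      InSpan (b ∷ bs) s × ¬ InSpan bs s → InSpan (b ∷ bs) t × ¬ InSpan bs t
    offSpan-resp {s} {t} s≈t (s∈ , s∉) =
      InSpan-resp (b ∷ bs) {s} {t} s≈t s∈ , s∉ ∘ InSpan-resp bs {t} {s} (P.sym {s} {t} s≈t)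

    length-offSpan : length (filter offSpan? points) ≡ q ^ length bs
    length-offSpan = ℕ.≤-antisym
      (surjective⇒length≤ P.setoid point (Unique.filter⁺ P.setoid offSpan? points-unique)
        (λ {t} t∈ → let _ , t∈S , t∉S = ∈-filter⁻ offSpan? {xs = points} t∈
                    in point-surjective t t∈S t∉S))
      (injective⇒≤length P.setoid point point-injective λ k →
        ∈-filter⁺ P.setoid offSpan? (λ {s} {t} → offSpan-resp {s} {t}) {v = point k} (points-complete (point k))
          (translate∈ (decode k) , translate∉ (decode k)))

  -- The number of points and the rank of the whole space.

  length-inSpan : ∀ {bs} → Independent bs →
    length (filter (InSpan? bs) points) ≡ geometricSum q (length bs)
  -- The zero space contains no points, since representatives are nonzero.
  length-inSpan {[]} [] = cong length (filter-none (InSpan? [])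
    (All.tabulate {xs = points} λ { {_ , v≉0} _ v∈ → v≉0 (Span-[] v∈) }))
  length-inSpan {b ∷ bs} (b∉ ∷ ind) = trans
    (length-filter-split (InSpan? bs) (InSpan? (b ∷ bs)) (Span-mono there) points)
    (cong₂ _+_ (length-inSpan ind) (Affine.length-offSpan b∉ ind))

  -- The listed representative of `t` is selected by `A` or by `∁ A`; in the latter case its line,
  -- and with it `t`, lies in the span.
  ∈span-∁⊎∈select : ∀ A → (t : NonzeroVector) →
    InSpan (vectors (∁ A)) t ⊎ t ∈ₚ select points A
  ∈span-∁⊎∈select A t with find (points-complete t)
  ... | s , s∈ , t≈s with select-∁ points A s∈
  ...   | inj₁ s∈A  = inj₂ (lose s∈A t≈s)
  ...   | inj₂ s∈∁A = inj₁ (InSpan-resp (vectors (∁ A)) {s} {t} (P.sym {t} {s} t≈s)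
                              (gen (∈-map⁺ proj₁ s∈∁A)))

  vectors-spanning : ∀ w → Span (vectors ⊤) w
  vectors-spanning w with w ≋? 0ᵥ
  ... | yes w≋0 = resp (λ j → ≈-sym (w≋0 j)) zero
  ... | no  w≉0 with ∈span-∁⊎∈select ⊤ (w , w≉0)
  -- This case is absorbed by monotonicity, as `∁ ⊤ ⊆ ⊤`.
  ...   | inj₁ w∈ = Span-mono (λ v∈ → let s , s∈ , eq = ∈-map⁻ proj₁ v∈ in
          subst (_∈ vectors ⊤) (sym eq)
            (∈-map⁺ proj₁ (select-mono points (∁ ⊤) ⊤ (⊆-max _) s∈))) w∈
  ...   | inj₂ w∈ with find w∈
  ...     | s , s∈ , w≈s = InSpan-resp (vectors ⊤) {s} {w , w≉0}
            (P.sym {w , w≉0} {s} w≈s) (gen (∈-map⁺ proj₁ s∈))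

  length-points-from-basis : ∀ {bs} → Independent bs → (∀ w → Span bs w) → length points ≡ geometricSum q n
  length-points-from-basis {bs} ind spanning = trans (length-all points)
    (trans (length-inSpan ind)
      (cong (geometricSum q) (basis-length (Independent⇒LinearlyIndependent ind) spanning)))
    where
    length-all : ∀ ts → length ts ≡ length (filter (InSpan? bs) ts)
    length-all ts = cong length (sym (filter-all (InSpan? bs) (All.universal (spanning ∘ proj₁) ts)))

  extension-spanning : ∀ {bs} (ext : Extension (vectors ⊤) bs) →
    ∀ w → Span (Extension.new ext ++ bs) w
  extension-spanning ext = Span-⊆ (Extension.spanning ext) ∘ vectors-spanning

  extension-length : ∀ {bs} (ext : Extension (vectors ⊤) bs) →
    length (Extension.new ext ++ bs) ≡ n
  extension-length ext = basis-length
    (Independent⇒LinearlyIndependent (Extension.independent ext)) (extension-spanning ext)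

  -- `dim` unfolds to the length of exactly this extension of the empty list.
  dim-⊤ : dim (vectors ⊤) ≡ n
  dim-⊤ = extension-length (extend (vectors ⊤) [])

  length-points : length points ≡ geometricSum q n
  length-points = length-points-from-basis (Extension.independent ext) (extension-spanning ext)
    where
    ext : Extension (vectors ⊤) []
    ext = extend (vectors ⊤) []

  -- Sets of points whose complement does not span.

  -- The translates of `b` give `q ^ length bs` points off the span of `bs`. None of them lies in
  -- the span of `∁ A`, so all lie in `A`.
  subspace-complement : ∀ A {b bs} → ¬ Span bs b → Independent bs →
    (∀ {v} → Span (vectors (∁ A)) v → Span bs v) → q ^ length bs ≤ length (select points A)
  subspace-complement A {b} {bs} b∉ ind ∁A⊆ =
    injective⇒≤length P.setoid point point-injective point∈
    where
    open Affine b∉ ind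

    point∈ : ∀ k → point k ∈ₚ select points A
    point∈ k = Sum.[ (λ p∈ → contradiction (∁A⊆ p∈) (translate∉ (decode k))) , id ]′
      (∈span-∁⊎∈select A (point k))

  -- Dropping the first vector of `new` from the basis leaves a basis of a hyperplane that still
  -- contains `base`, hence the span of `∁ A`.
  extension-complement : ∀ A {base} → (∀ {v} → Span (vectors (∁ A)) v → Span base v) →
    length base < n → ∀ new → Independent (new ++ base) → length (new ++ base) ≡ n →
    q ^ (n ∸ 1) ≤ length (select points A)
  extension-complement A ∁A⊆ base<n []        _          eq = contradiction eq (ℕ.<⇒≢ base<n)
  extension-complement A ∁A⊆ base<n (b ∷ new) (b∉ ∷ ind) eq =
    subst (λ d → q ^ d ≤ length (select points A)) (cong (_∸ 1) eq)
      (subspace-complement A b∉ ind (Span-mono (∈-++⁺ʳ new) ∘ ∁A⊆))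

  nonspanning-complement : ∀ A → dim (vectors (∁ A)) < n → q ^ (n ∸ 1) ≤ ∣ A ∣
  nonspanning-complement A d<n = subst (q ^ (n ∸ 1) ≤_) (length-select points A)
    -- `d<n` bounds the length of `base` as well, because `dim` is by definition the length of that
    -- basis.
    (extension-complement A (Span-⊆ (Extension.spanning base)) d<n
      (Extension.new ext) (Extension.independent ext) (extension-length ext))
    where
    base : Extension (vectors (∁ A)) []
    base = extend (vectors (∁ A)) []

    ext : Extension (vectors ⊤) (Extension.new base ++ [])
    ext = extend (vectors ⊤) (Extension.independent base)

-- Closed form for the point count and ranks in the dual.

∣∁⊤∣≡0 : ∀ m → ∣ ∁ (⊤ {m}) ∣ ≡ 0
∣∁⊤∣≡0 zero    = refl
∣∁⊤∣≡0 (suc m) = ∣∁⊤∣≡0 m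

geometricSum≡quotient : ∀ q .{{_ : NonZero (q ∸ 1)}} d → geometricSum q d ≡ (q ^ d ∸ 1) / (q ∸ 1)
-- For `q = 0` the divisor `q ∸ 1` would be zero.
geometricSum≡quotient zero    d = contradiction refl (≢-nonZero⁻¹ 0)
geometricSum≡quotient (suc r) d = begin
  geometricSum (suc r) d            ≡⟨ m*n/n≡m (geometricSum (suc r) d) r ⟨
  geometricSum (suc r) d * r / r    ≡⟨ cong (λ m → (m ∸ 1) / r) (suc-geometricSum r d) ⟩
  (suc r ^ d ∸ 1) / r               ∎
  where open ≡-Reasoning

module DualPG {c ℓ q} (F : FiniteField c ℓ q) (n : ℕ) where
  open LinearAlgebra F n using (points; dim; vectors; 1<q)
  open PointCounting F n
  private
    module PG = Matroid (PG F n)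
    module PG* = Matroid (dual (PG F n))

  q^d>0 : ∀ d → 0 < q ^ d
  q^d>0 d = ℕ.m^n>0 q ⦃ >-nonZero (ℕ.<-trans (s≤s z≤n) 1<q) ⦄ d

  rank*-⊤ : PG*.rank ⊤ ≡ length points ∸ n
  rank*-⊤ = cong₂ _∸_ (cong₂ _+_ rank-∁⊤ (∣⊤∣≡n (length points))) dim-⊤
    where
    rank-∁⊤ : PG.rank (∁ ⊤) ≡ 0
    rank-∁⊤ = ℕ.n≤0⇒n≡0 (subst (PG.rank (∁ ⊤) ≤_) (∣∁⊤∣≡0 (length points)) (PG.rank≤∣∣ (∁ ⊤)))

  -- The complement of `A` spans, so `rank ⊤` cancels in the dual rank.
  rank*-small : ∀ A → ∣ A ∣ ≤ q ^ (n ∸ 1) ∸ 1 → PG*.rank A ≡ ∣ A ∣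
  rank*-small A ∣A∣≤ = trans (cong (λ r → r + ∣ A ∣ ∸ PG.rank ⊤) rank-∁A≡) (ℕ.m+n∸m≡n (PG.rank ⊤) ∣ A ∣)
    where
    ∣A∣< : ∣ A ∣ < q ^ (n ∸ 1)
    -- Positivity of `q ^ (n ∸ 1)` makes the truncated predecessor strictly smaller.
    ∣A∣< = ℕ.≤-<-trans ∣A∣≤ (ℕ.∸-monoʳ-< (s≤s z≤n) (q^d>0 (n ∸ 1)))

    rank-∁A≡ : PG.rank (∁ A) ≡ PG.rank ⊤
    rank-∁A≡ = ℕ.≤-antisym (PG.rank-mono (∁ A) ⊤ (⊆-max (∁ A)))
      (subst (_≤ PG.rank (∁ A)) (sym dim-⊤)
        (ℕ.≮⇒≥ (λ r<n → ℕ.<⇒≱ ∣A∣< (nonspanning-complement A r<n))))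

  -- The last summand `q ^ (n ∸ 1)` of the point count already exceeds the bound.
  k≤size : 1 ≤ n → q ^ (n ∸ 1) ∸ 1 ≤ length points
  k≤size (s≤s {n = d} _) = subst (q ^ d ∸ 1 ≤_) (sym length-points)
    (ℕ.≤-trans (ℕ.m∸n≤m (q ^ d) 1) (ℕ.m≤n+m (q ^ d) (geometricSum q d)))

  -- Abstracting `N` and `N′` lets the point count and the dual rank be replaced by closed forms
  -- while the polynomial stays fixed.
  TopCoefficients : ℕ → ℕ → Set
  TopCoefficients N N′ =
      (∀ d → N′ < d → coeff (characteristicPolynomial (dual (PG F n))) d ≡ 0ℤ)
    × (∀ i → i < q ^ (n ∸ 1) ∸ 1 →
        coeff (characteristicPolynomial (dual (PG F n))) (N′ ∸ i) ≡ (-1ℤ ^ℤ i) *ℤ (+ (N C i)))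

  topCoefficients : 1 ≤ n → TopCoefficients (length points) (PG*.rank ⊤)
  topCoefficients 1≤n = coeff-degree> (dual (PG F n)) ,
    coeff-top (dual (PG F n)) rank*-small (k≤size 1≤n)

corollary3 : ∀ {c ℓ} (q : ℕ) (q-primePower : IsPrimePower q) (F : FiniteField c ℓ q) (n : ℕ) → 1 ≤ n →
    let
    N  = _/_ (q ^ n ∸ 1) (q ∸ 1) {{primePower⇒∸1-nonZero q-primePower}}
    N′ = N ∸ n
    k  = q ^ (n ∸ 1) ∸ 1
    χ  = characteristicPolynomial (dual (PG F n))
    in (∀ d → N′ < d → coeff χ d ≡ 0ℤ)
    × (∀ i → i < k → coeff χ (N′ ∸ i) ≡ (-1ℤ ^ℤ i) *ℤ (+ (N C i)))
corollary3 q q-primePower F n 1≤n =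
  -- The inner rewriting turns the dual rank into `length points ∸ n`; the outer one then replaces
  -- both occurrences of `length points` at once.
  subst (λ N → TopCoefficients N (N ∸ n))
    (trans length-points (geometricSum≡quotient q {{primePower⇒∸1-nonZero q-primePower}} n))
    (subst (TopCoefficients _) rank*-⊤ (topCoefficients 1≤n))
  where
  open DualPG F n
  open PointCounting F n
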